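{- Let $n\geq 1$ and let $\mathcal{N}:L_n([0,1])\to L_n([0,1])$ be a function. Then $\mathcal{N}$ is an $n$-dimensional strong fuzzy negation if and only if there exists a strong fuzzy negation $N:[0,1]\to[0,1]$ such that $\mathcal{N}=\widetilde{N}$.
   Context: $L_n([0,1])=\{(x_1,\ldots,x_n)\in[0,1]^n : x_1\leq\cdots\leq x_n\}$, with projections $\pi_i(x_1,\ldots,x_n)=x_i$ and the componentwise order. For $x\in[0,1]$, $/x/=(x,\ldots,x)$. A fuzzy negation is a function $N:[0,1]\to[0,1]$ with $N(0)=1$, $N(1)=0$ and $N(x)\geq N(y)$ whenever $x\leq y$; it is strong if $N(N(x))=x$ for all $x$. An $n$-dimensional fuzzy negation is a function $\mathcal{N}:L_n([0,1])\to L_n([0,1])$ with $\mathcal{N}(/0/)=/1/$, $\mathcal{N}(/1/)=/0/$ and $\mathcal{N}(\mathbf{x})\geq\mathcal{N}(\mathbf{y})$ whenever $\mathbf{x}\leq\mathbf{y}$; it is strong if $\mathcal{N}(\mathcal{N}(\mathbf{x}))=\mathbf{x}$ for all $\mathbf{x}$. For a fuzzy negation $N$, $\widetilde{N}(\mathbf{x})=(N(\pi_n(\mathbf{x})),N(\pi_{n-1}(\mathbf{x})),\ldots,N(\pi_1(\mathbf{x})))$. -}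

module Defs where

open import Algebra.Definitions using (Involutive)
open import Data.Fin.Base as Fin using (Fin; toℕ; opposite)
open import Data.Fin.Properties using (opposite-prop)
import Data.Nat.Base as ℕ
open import Data.Nat.Base using (ℕ; s≤s)
open import Data.Nat.Properties using (∸-monoʳ-≤)
open import Data.Product.Base using (∃; _×_; _,_; proj₁; proj₂)
open import Data.Rational.Base as ℚ using (ℚ; 0ℚ; 1ℚ)
import Data.Rational.Properties as ℚ
open import Data.Sum.Base using (_⊎_; inj₁; inj₂)
open import Data.Vec.Functional using (Vector; map; replicate; reverse)
open import Data.Vec.Functional.Relation.Binary.Pointwise using (Pointwise)
open import Function.Bundles using (Func; _⟨$⟩_; _⇔_; mk⇔)
open import Level using (Level; 0ℓ; _⊔_) renaming (suc to lsuc)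
open import Relation.Binary.Bundles using (Poset)
open import Relation.Binary.Core using (Rel)
import Relation.Binary.Construct.Interior.Symmetric as SymInterior
import Relation.Binary.Construct.On as On
open import Relation.Binary.Definitions using (Antitonic₁; tri<; tri≈; tri>)
open import Relation.Binary.PropositionalEquality
  using (refl; subst; subst₂; sym)
open import Relation.Nullary using (¬_)

-- Dedekind reals as two-sided located cuts.  Two cuts are regarded as the same
-- real when each is ≤ the other (see ℝ-poset), so sets and functions of reals
-- are handled as setoids and setoid maps.

record ℝ : Set₁ where
  field
    L U         : ℚ → Set
    L-inhabited : ∃ L
    U-inhabited : ∃ U
    L-rounded   : ∀ q → L q ⇔ ∃ λ r → q ℚ.< r × L r
    U-rounded   : ∀ r → U r ⇔ ∃ λ q → q ℚ.< r × U q
    disjoint    : ∀ q → ¬ (L q × U q)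
    located     : ∀ {q r} → q ℚ.< r → L q ⊎ U r

-- Lower cuts suffice: by roundedness, disjointness and locatedness, inclusion
-- of lower cuts is the same as reverse inclusion of upper cuts.
infix 4 _≤ℝ_
_≤ℝ_ : Rel ℝ 0ℓ
x ≤ℝ y = ∀ q → ℝ.L x q → ℝ.L y q

ℝ-poset : Poset (lsuc 0ℓ) 0ℓ 0ℓ
ℝ-poset = SymInterior.poset {R = _≤ℝ_}
  (λ _ q∈L → q∈L)
  (λ x≤y y≤z q q∈L → y≤z q (x≤y q q∈L))

fromℚ : ℚ → ℝ
fromℚ p = record
  { L           = ℚ._< p
  ; U           = p ℚ.<_
  ; L-inhabited = p ℚ.+ ℚ.- 1ℚ , subst (p ℚ.+ ℚ.- 1ℚ ℚ.<_) (ℚ.+-identityʳ p)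
                    (ℚ.+-monoʳ-< p (ℚ.negative⁻¹ (ℚ.- 1ℚ)))
  ; U-inhabited = p ℚ.+ 1ℚ , subst (ℚ._< p ℚ.+ 1ℚ) (ℚ.+-identityʳ p)
                    (ℚ.+-monoʳ-< p (ℚ.positive⁻¹ 1ℚ))
  ; L-rounded   = λ q → mk⇔ ℚ.<-dense (λ (_ , q<r , r<p) → ℚ.<-trans q<r r<p)
  ; U-rounded   = λ r → mk⇔
                    (λ p<r → let (q , p<q , q<r) = ℚ.<-dense p<r in q , q<r , p<q)
                    (λ (_ , q<r , p<q) → ℚ.<-trans p<q q<r)
  ; disjoint    = λ _ (q<p , p<q) → ℚ.<-asym q<p p<q
  ; located     = located
  }
  where
  located : ∀ {q r} → q ℚ.< r → q ℚ.< p ⊎ p ℚ.< r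
  located {q} q<r with ℚ.<-cmp q p
  ... | tri< q<p _ _  = inj₁ q<p
  ... | tri≈ _ refl _ = inj₂ q<r
  ... | tri> _ _ p<q  = inj₂ (ℚ.<-trans p<q q<r)

record UnitInterval : Set₁ where
  constructor mk
  field
    value : ℝ
    0≤    : fromℚ 0ℚ ≤ℝ value
    ≤1    : value ≤ℝ fromℚ 1ℚ

-- [0,1]
𝕀 : Poset (lsuc 0ℓ) 0ℓ 0ℓ
𝕀 = On.poset ℝ-poset UnitInterval.value

module 𝕀 = Poset 𝕀

0≤1 : fromℚ 0ℚ ≤ℝ fromℚ 1ℚ
0≤1 _ q<0 = ℚ.<-trans q<0 (ℚ.positive⁻¹ 1ℚ)

0𝕀 1𝕀 : UnitInterval
0𝕀 = mk (fromℚ 0ℚ) (λ _ q∈L → q∈L) 0≤1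
1𝕀 = mk (fromℚ 1ℚ) 0≤1 (λ _ q∈L → q∈L)

record Increasing (n : ℕ) : Set₁ where
  constructor mk
  field
    π    : Vector UnitInterval n
    mono : ∀ {i j} → i Fin.≤ j → π i 𝕀.≤ π j

open Increasing public using (π)

pointwisePoset : ∀ {c ℓ₁ ℓ₂} → Poset c ℓ₁ ℓ₂ → ℕ → Poset c ℓ₁ ℓ₂
pointwisePoset P n = record
  { Carrier        = Vector Carrier n
  ; _≈_            = Pointwise _≈_
  ; _≤_            = Pointwise _≤_
  ; isPartialOrder = record
    { isPreorder = record
      { isEquivalence = record
        { refl  = λ _ → Eq.refl
        ; sym   = λ x≈y i → Eq.sym (x≈y i)
        ; trans = λ x≈y y≈z i → Eq.trans (x≈y i) (y≈z i)
        }
      ; reflexive = λ x≈y i → reflexive (x≈y i)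
      ; trans     = λ x≤y y≤z i → trans (x≤y i) (y≤z i)
      }
    ; antisym = λ x≤y y≤x i → antisym (x≤y i) (y≤x i)
    }
  }
  where open Poset P

-- Lₙ([0,1]); coordinates are indexed by Fin n, hence counted from 0.
𝕃 : ℕ → Poset (lsuc 0ℓ) 0ℓ 0ℓ
𝕃 n = On.poset (pointwisePoset 𝕀 n) π

/_/ : ∀ {n} → UnitInterval → Increasing n
/ x / = mk (replicate _ x) (λ _ → 𝕀.refl {x})

Map : ∀ {c ℓ₁ ℓ₂} → Poset c ℓ₁ ℓ₂ → Set (c ⊔ ℓ₁)
Map P = Func (Poset.Eq.setoid P) (Poset.Eq.setoid P)

module Negation {c ℓ₁ ℓ₂ : Level} (P : Poset c ℓ₁ ℓ₂) (𝟘 𝟙 : Poset.Carrier P) where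

  open Poset P

  record IsNegation (N : Map P) : Set (c ⊔ ℓ₁ ⊔ ℓ₂) where
    field
      N𝟘≈𝟙     : N ⟨$⟩ 𝟘 ≈ 𝟙
      N𝟙≈𝟘     : N ⟨$⟩ 𝟙 ≈ 𝟘
      antitone : Antitonic₁ _≤_ _≤_ (N ⟨$⟩_)

  record IsStrongNegation (N : Map P) : Set (c ⊔ ℓ₁ ⊔ ℓ₂) where
    field
      isNegation : IsNegation N
      involutive : Involutive _≈_ (N ⟨$⟩_)

    open IsNegation isNegation public

open Negation 𝕀 0𝕀 1𝕀 public using () renaming
  ( IsNegation       to IsFuzzyNegation
  ; IsStrongNegation to IsStrongFuzzyNegation
  )

module _ (n : ℕ) where
  open Negation (𝕃 n) / 0𝕀 / / 1𝕀 / public using () renaming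
    ( IsNegation       to IsDimFuzzyNegation
    ; IsStrongNegation to IsStrongDimFuzzyNegation
    )

opposite-anti-≤ : ∀ {n} {i j : Fin n} → i Fin.≤ j → opposite j Fin.≤ opposite i
opposite-anti-≤ {n} {i} {j} i≤j =
  subst₂ ℕ._≤_ (sym (opposite-prop j)) (sym (opposite-prop i))
    (∸-monoʳ-≤ n (s≤s i≤j))

-- Ñ
tilde : ∀ {n} (N : Map 𝕀) → IsFuzzyNegation N → Map (𝕃 n)
tilde N isNeg = record
  { to   = λ 𝐱 → mk (map (N ⟨$⟩_) (reverse (π 𝐱)))
      (λ i≤j → antitone (Increasing.mono 𝐱 (opposite-anti-≤ i≤j)))
  ; cong = λ x≈y i → Func.cong N (x≈y (opposite i))
  }
  where open Negation.IsNegation isNeg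

{-# OPTIONS --safe #-}
-- For i : Fin n let  J i x = (0,…,0,x,…,x)  and  M i x = (x,…,x,1,…,1),  with
-- coordinate i the first, respectively the last, to be x.  Then J i x ≤ p iff
-- x ≤ pᵢ, and p ≤ M i x iff pᵢ ≤ x, so the J i x are join-prime and the M i x
-- meet-prime.  As 𝒩 is an anti-automorphism, w = 𝒩 (M k x) is join-prime, and
-- w ≤ /wᵢ/ ∨ M i 0 yields wᵢ = 0 or w ≤ /wᵢ/; dually for 𝒩 (J k x).  Hence 𝒩
-- sends constants and the vertices (0,…,0,1,…,1), being both join- and
-- meet-prime, to constants or vertices.  If 𝒩 (0,1,…,1) were an interior
-- constant /c/, then for 0 < z < c the element 𝒩 /z/ would be a constant or
-- vertex strictly above (0,1,…,1), hence /1/, although z ≠ 0.  So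
-- 𝒩 (0,1,…,1) ≥ (0,…,0,1); by induction along the chain of vertices 𝒩 reverses
-- that chain, and it maps constants to constants.  Now x lies above
-- J i xᵢ = /xᵢ/ ∧ J i 1 and below M i xᵢ = /xᵢ/ ∨ M i 0, and applying 𝒩
-- determines the coordinate of 𝒩 x opposite to i.
--
-- The order of [0,1] is ¬¬-stable, so any finite number of classical case
-- distinctions is permitted in the proof of an inequality.
module Submission where

open import Data.Empty using (⊥; ⊥-elim)
open import Data.Fin.Base as Fin
  using (Fin; zero; suc; toℕ; fromℕ; inject₁; opposite)
open import Data.Fin.Induction using (<-weakInduction; >-weakInduction)
open import Data.Fin.Properties
  using (_≤?_; ≤fromℕ; toℕ-inject₁; opposite-involutive)
open import Data.Nat.Base as ℕ using (ℕ; zero; suc; _≥_; z≤n; s≤s; z<s)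
import Data.Nat.Properties as ℕ
open import Data.Product.Base using (Σ-syntax; ∃-syntax; _×_; _,_)
open import Data.Rational.Base as ℚ using (ℚ; 0ℚ; 1ℚ)
import Data.Rational.Properties as ℚ
open import Data.Sum.Base using (_⊎_; inj₁; inj₂)
open import Function.Bundles using (Func; _⟨$⟩_; _⇔_; mk⇔; Equivalence)
open import Relation.Binary.Bundles using (Poset)
open import Relation.Binary.Construct.Interior.Symmetric using (_,_; lhs≤rhs; rhs≤lhs)
open import Relation.Binary.Definitions using (tri<; tri≈; tri>)
open import Relation.Binary.PropositionalEquality
  using (_≡_; refl; cong; sym; trans; subst)
open import Relation.Nullary using (¬_; yes; no)
open import Relation.Nullary.Negation using (contradiction)
open import Defs

-- The order of [0,1]

L-down : ∀ (x : ℝ) {q r} → q ℚ.< r → ℝ.L x r → ℝ.L x q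
L-down x {q} {r} q<r r∈L = Equivalence.from (ℝ.L-rounded x q) (r , q<r , r∈L)

L<U : ∀ (x : ℝ) {q r} → ℝ.L x q → ℝ.U x r → q ℚ.< r
L<U x {q} {r} q∈L r∈U with ℚ.<-cmp q r
... | tri< q<r _ _  = q<r
... | tri≈ _ refl _ = contradiction (q∈L , r∈U) (ℝ.disjoint x q)
... | tri> _ _ r<q  = contradiction (L-down x r<q q∈L , r∈U) (ℝ.disjoint x r)

-- Roundedness gives `r > q` still below `x`. Locatedness then puts `q` below `y` or `r` above `y`,
-- and the latter refutes `x ≤ℝ y`.
≤-stable : ∀ (x y : ℝ) → ¬ ¬ (x ≤ℝ y) → x ≤ℝ y
≤-stable x y ¬¬x≤y q q∈x with Equivalence.to (ℝ.L-rounded x q) q∈x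
... | r , q<r , r∈x with ℝ.located y q<r
...   | inj₁ q∈y  = q∈y
...   | inj₂ r∈Uy = ⊥-elim (¬¬x≤y (λ x≤y → ℝ.disjoint y r (x≤y r r∈x , r∈Uy)))

≤-¬¬total : ∀ (x y : ℝ) → ¬ ¬ (x ≤ℝ y ⊎ y ≤ℝ x)
≤-¬¬total x y k = k (inj₁ x≤y)
  where
  x≤y : x ≤ℝ y
  x≤y q q∈x with Equivalence.to (ℝ.L-rounded x q) q∈x
  ... | r , q<r , r∈x with ℝ.located y q<r
  ...   | inj₁ q∈y  = q∈y
  ...   | inj₂ r∈Uy =
    ⊥-elim (k (inj₂ (λ s s∈y → L-down x (L<U y s∈y r∈Uy) r∈x)))

1≰0 : ¬ (1𝕀 𝕀.≤ 0𝕀)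
1≰0 1≤0 = ℚ.<-irrefl refl (1≤0 0ℚ (ℚ.positive⁻¹ 1ℚ))

between : ∀ c → ¬ (c 𝕀.≤ 0𝕀) →
  ¬ ¬ (∃[ z ] z 𝕀.≤ c × ¬ (z 𝕀.≤ 0𝕀) × ¬ (c 𝕀.≤ z))
between c c≰0 k = c≰0 c≤0
  where
  C = UnitInterval.value c
  c≤0 : c 𝕀.≤ 0𝕀
  c≤0 q q∈c with q ℚ.<? 0ℚ
  ... | yes q<0 = q<0
  ... | no  q≮0 with Equivalence.to (ℝ.L-rounded C q) q∈c
  -- Roundedness is used twice: `z` is the rational `p`, positive since `0 ≤ q < p`, and `r > p`
  -- below `c` witnesses that `c ≤ z` fails.
  ...   | p , q<p , p∈c with Equivalence.to (ℝ.L-rounded C p) p∈c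
  ...     | r , p<r , r∈c = ⊥-elim (k (z , z≤c , z≰0 , c≰z))
    where
    0<p : 0ℚ ℚ.< p
    0<p = ℚ.≤-<-trans (ℚ.≮⇒≥ q≮0) q<p
    z : UnitInterval
    z = mk (fromℚ p)
           (λ _ s<0 → ℚ.<-trans s<0 0<p)
           (λ _ s<p → ℚ.<-trans s<p (UnitInterval.≤1 c p p∈c))
    z≤c : z 𝕀.≤ c
    z≤c _ s<p = L-down C s<p p∈c
    z≰0 : ¬ (z 𝕀.≤ 0𝕀)
    z≰0 z≤0 = ℚ.<-irrefl refl (z≤0 0ℚ 0<p)
    c≰z : ¬ (c 𝕀.≤ z)
    c≰z c≤z = ℚ.<-asym p<r (c≤z r r∈c)

0≤ : ∀ x → 0𝕀 𝕀.≤ x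
0≤ = UnitInterval.0≤

≤1 : ∀ x → x 𝕀.≤ 1𝕀
≤1 = UnitInterval.≤1

by-contra : ∀ x y → ¬ ¬ (x 𝕀.≤ y) → x 𝕀.≤ y
by-contra x y = ≤-stable (UnitInterval.value x) (UnitInterval.value y)

by-cases : ∀ {a b} {A : Set a} {B : Set b} x y →
  ¬ ¬ (A ⊎ B) → (A → x 𝕀.≤ y) → (B → x 𝕀.≤ y) → x 𝕀.≤ y
by-cases x y A⊎B f g = by-contra x y λ x≰y → A⊎B λ
  { (inj₁ a) → x≰y (f a)
  ; (inj₂ b) → x≰y (g b)
  }

-- Both orders are written as families of inclusions between predicates on ℚ:
-- in this form Agda infers the middle term of a chain.
infixr 5 _⨾_ _⨟_
_⨾_ : {P Q R : ℚ → Set} → (∀ q → P q → Q q) → (∀ q → Q q → R q) → ∀ q → P q → R q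
(P⊆Q ⨾ Q⊆R) q q∈P = Q⊆R q (P⊆Q q q∈P)

_⨟_ : ∀ {n} {P Q R : Fin n → ℚ → Set} →
  (∀ i q → P i q → Q i q) → (∀ i q → Q i q → R i q) → ∀ i q → P i q → R i q
(P⊆Q ⨟ Q⊆R) i = P⊆Q i ⨾ Q⊆R i

-- The elements J i x and M i x

infix 4 _⊑_
_⊑_ : ∀ {n} → Increasing n → Increasing n → Set
_⊑_ {n} = Poset._≤_ (𝕃 n)

module _ {n : ℕ} where

  J : Fin n → UnitInterval → Increasing n
  J i x = mk p (λ {j} {k} → mono j k)
    where
    p : Fin n → UnitInterval
    p j with i ≤? j
    ... | yes _ = x
    ... | no  _ = 0𝕀
    mono : ∀ j k → j Fin.≤ k → p j 𝕀.≤ p k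
    mono j k j≤k with i ≤? j | i ≤? k
    ... | yes _   | yes _   = 𝕀.refl {x}
    ... | yes i≤j | no  i≰k = contradiction (ℕ.≤-trans i≤j j≤k) i≰k
    ... | no  _   | yes _   = 0≤ x
    ... | no  _   | no  _   = 𝕀.refl {0𝕀}

  M : Fin n → UnitInterval → Increasing n
  M i x = mk p (λ {j} {k} → mono j k)
    where
    p : Fin n → UnitInterval
    p j with j ≤? i
    ... | yes _ = x
    ... | no  _ = 1𝕀
    mono : ∀ j k → j Fin.≤ k → p j 𝕀.≤ p k
    mono j k j≤k with j ≤? i | k ≤? i
    ... | yes _   | yes _   = 𝕀.refl {x}
    ... | yes _   | no  _   = ≤1 x
    ... | no  j≰i | yes k≤i = contradiction (ℕ.≤-trans j≤k k≤i) j≰i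
    ... | no  _   | no  _   = 𝕀.refl {1𝕀}

  J-lookup : ∀ i x j → i Fin.≤ j → x 𝕀.≤ π (J i x) j
  J-lookup i x j i≤j with i ≤? j
  ... | yes _   = 𝕀.refl {x}
  ... | no  i≰j = contradiction i≤j i≰j

  J-zero : ∀ i x j → j Fin.< i → π (J i x) j 𝕀.≤ 0𝕀
  J-zero i x j j<i with i ≤? j
  ... | yes i≤j = contradiction i≤j (ℕ.<⇒≱ j<i)
  ... | no  _   = 𝕀.refl {0𝕀}

  M-lookup : ∀ i x j → j Fin.≤ i → π (M i x) j 𝕀.≤ x
  M-lookup i x j j≤i with j ≤? i
  ... | yes _   = 𝕀.refl {x}
  ... | no  j≰i = contradiction j≤i j≰i

  M-one : ∀ i x j → i Fin.< j → 1𝕀 𝕀.≤ π (M i x) j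
  M-one i x j i<j with j ≤? i
  ... | yes j≤i = contradiction j≤i (ℕ.<⇒≱ i<j)
  ... | no  _   = 𝕀.refl {1𝕀}

  J-least : ∀ i x p → x 𝕀.≤ π p i → J i x ⊑ p
  J-least i x p x≤pᵢ j with i ≤? j
  ... | yes i≤j = x≤pᵢ ⨾ Increasing.mono p i≤j
  ... | no  _   = 0≤ (π p j)

  M-greatest : ∀ i x p → π p i 𝕀.≤ x → p ⊑ M i x
  M-greatest i x p pᵢ≤x j with j ≤? i
  ... | yes j≤i = Increasing.mono p j≤i ⨾ pᵢ≤x
  ... | no  _   = ≤1 (π p j)

  -- Meets and joins are never constructed: of `J i x = / x / ∧ J i 1𝕀` only the
  -- greatest-lower-bound half is used, and dually for `M-join`.
  J-meet : ∀ i x p → p ⊑ / x / → p ⊑ J i 1𝕀 → p ⊑ J i x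
  J-meet i x p p≤x p≤J j with i ≤? j | p≤J j
  ... | yes _ | _    = p≤x j
  ... | no  _ | pⱼ≤0 = pⱼ≤0

  M-join : ∀ i x p → / x / ⊑ p → M i 0𝕀 ⊑ p → M i x ⊑ p
  M-join i x p x≤p M≤p j with j ≤? i | M≤p j
  ... | yes _ | _    = x≤p j
  ... | no  _ | 1≤pⱼ = 1≤pⱼ

inject₁<suc : ∀ {m} (i : Fin m) → inject₁ i Fin.< suc i
inject₁<suc i = s≤s (ℕ.≤-reflexive (toℕ-inject₁ i))

inject₁-or-suc : ∀ {m} (i : Fin m) (j : Fin (suc m)) → j Fin.≤ inject₁ i ⊎ suc i Fin.≤ j
inject₁-or-suc i j with j ≤? inject₁ i
... | yes j≤i = inj₁ j≤i
... | no  j≰i = inj₂ (subst (λ k → k ℕ.≤ toℕ j) (cong suc (toℕ-inject₁ i)) (ℕ.≰⇒> j≰i))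

-- Both sides are the vertex with zeros up to coordinate `i` and ones after it. Having both
-- descriptions makes this vertex meet-prime as well as join-prime.
M-inject₁⊑J-suc : ∀ {m} (i : Fin m) → M (inject₁ i) 0𝕀 ⊑ J (suc i) 1𝕀
M-inject₁⊑J-suc i j with inject₁-or-suc i j
... | inj₁ j≤i = M-lookup (inject₁ i) 0𝕀 j j≤i ⨾ 0≤ (π (J (suc i) 1𝕀) j)
... | inj₂ i<j = ≤1 (π (M (inject₁ i) 0𝕀) j) ⨾ J-lookup (suc i) 1𝕀 j i<j

J-suc⊑M-inject₁ : ∀ {m} (i : Fin m) → J (suc i) 1𝕀 ⊑ M (inject₁ i) 0𝕀
J-suc⊑M-inject₁ i =
  J-least (suc i) 1𝕀 (M (inject₁ i) 0𝕀) (M-one (inject₁ i) 0𝕀 (suc i) (inject₁<suc i))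

-- The mirror equation `opposite (suc j) = inject₁ (opposite j)` holds by computation; involutivity
-- turns it round.
opposite-inject₁ : ∀ {m} (i : Fin m) → opposite (inject₁ i) ≡ suc (opposite i)
opposite-inject₁ i = trans (cong (λ j → opposite (inject₁ j)) (sym (opposite-involutive i)))
                           (opposite-involutive (suc (opposite i)))

-- Strong negations of Lₙ([0,1])

module Strong {m : ℕ} (𝒩 : Map (𝕃 (suc m)))
              (strong : IsStrongDimFuzzyNegation (suc m) 𝒩) where

  open IsStrongDimFuzzyNegation (suc m) strong

  private
    𝕃ₙ = Increasing (suc m)
    last : Fin (suc m)
    last = fromℕ m

  neg : 𝕃ₙ → 𝕃ₙ
  neg = 𝒩 ⟨$⟩_

  neg-anti : ∀ x y → x ⊑ y → neg y ⊑ neg x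
  neg-anti x y = antitone {y} {x}

  neg²≤ : ∀ x → neg (neg x) ⊑ x
  neg²≤ x i = lhs≤rhs (involutive x i)

  neg²≥ : ∀ x → x ⊑ neg (neg x)
  neg²≥ x i = rhs≤lhs (involutive x i)

  neg-swapʳ : ∀ x y → x ⊑ neg y → y ⊑ neg x
  neg-swapʳ x y x≤ = neg²≥ y ⨟ neg-anti x (neg y) x≤

  neg-swapˡ : ∀ x y → neg x ⊑ y → neg y ⊑ x
  neg-swapˡ x y ≤y = neg-anti (neg x) y ≤y ⨟ neg²≤ x

  neg-cancel : ∀ x y → neg x ⊑ neg y → y ⊑ x
  neg-cancel x y p = neg²≥ y ⨟ neg-swapˡ x (neg y) p

  neg-1≤ : ∀ x → / 1𝕀 / ⊑ x → neg x ⊑ / 0𝕀 /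
  neg-1≤ x 1≤x = neg-anti / 1𝕀 / x 1≤x ⨟ (λ i → lhs≤rhs (N𝟙≈𝟘 i))

  neg-≤0 : ∀ x → x ⊑ / 0𝕀 / → / 1𝕀 / ⊑ neg x
  neg-≤0 x x≤0 = (λ i → rhs≤lhs (N𝟘≈𝟙 i)) ⨟ neg-anti x / 0𝕀 / x≤0

  -- Join-primeness of `neg v`, applied to `neg v ⊑ a ∨ b`. Taking `v` only equivalent to `M k x`
  -- covers constants, with `k` the last coordinate.
  neg-M-cases : ∀ v k x → v ⊑ M k x → M k x ⊑ v → ∀ i →
    ¬ ¬ (π (neg v) i 𝕀.≤ 0𝕀 ⊎ neg v ⊑ / π (neg v) i /)
  neg-M-cases v k x v≤M M≤v i ¬cases =
    ≤-¬¬total (UnitInterval.value (π (neg a) k)) (UnitInterval.value (π (neg b) k)) λ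
      { (inj₁ a≤b) → ¬cases (inj₂
          (above a (lower (π (neg a) k) (λ _ q∈L → q∈L) a≤b)))
      ; (inj₂ b≤a) → ¬cases (inj₁
          (above b (lower (π (neg b) k) b≤a (λ _ q∈L → q∈L)) i ⨾ M-lookup i 0𝕀 i ℕ.≤-refl))
      }
    where
    wᵢ : UnitInterval
    wᵢ = π (neg v) i
    a b : 𝕃ₙ
    a = / wᵢ /
    b = M i 0𝕀
    -- Here `c` is the smaller of the coordinates `k` of `neg a` and `neg b`, so `J k c` lies below
    -- both, and `neg v ⊑ a ∨ b ⊑ neg (J k c)`.
    lower : ∀ c → c 𝕀.≤ π (neg a) k → c 𝕀.≤ π (neg b) k → c 𝕀.≤ x
    lower c c≤a c≤b =
      J-lookup k c k ℕ.≤-refl ⨾ neg-cancel v (J k c) w≤ k ⨾ v≤M k ⨾ M-lookup k x k ℕ.≤-refl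
      where
      w≤ : neg v ⊑ neg (J k c)
      w≤ = M-greatest i wᵢ (neg v) (𝕀.refl {wᵢ}) ⨟
           M-join i wᵢ (neg (J k c))
             (neg-swapʳ (J k c) a (J-least k c (neg a) c≤a))
             (neg-swapʳ (J k c) b (J-least k c (neg b) c≤b))
    above : ∀ y → π (neg y) k 𝕀.≤ x → neg v ⊑ y
    above y y≤x = neg-swapˡ y v (M-greatest k x (neg y) y≤x ⨟ M≤v)

  neg-J-cases : ∀ v k x → v ⊑ J k x → J k x ⊑ v → ∀ i →
    ¬ ¬ (1𝕀 𝕀.≤ π (neg v) i ⊎ / π (neg v) i / ⊑ neg v)
  neg-J-cases v k x v≤J J≤v i ¬cases =
    ≤-¬¬total (UnitInterval.value (π (neg a) k)) (UnitInterval.value (π (neg b) k)) λ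
      { (inj₁ a≤b) → ¬cases (inj₁
          (J-lookup i 1𝕀 i ℕ.≤-refl ⨾ below b (upper (π (neg b) k) a≤b (λ _ q∈L → q∈L)) i))
      ; (inj₂ b≤a) → ¬cases (inj₂
          (below a (upper (π (neg a) k) (λ _ q∈L → q∈L) b≤a)))
      }
    where
    wᵢ : UnitInterval
    wᵢ = π (neg v) i
    a b : 𝕃ₙ
    a = / wᵢ /
    b = J i 1𝕀
    upper : ∀ c → π (neg a) k 𝕀.≤ c → π (neg b) k 𝕀.≤ c → x 𝕀.≤ c
    upper c a≤c b≤c =
      J-lookup k x k ℕ.≤-refl ⨾ J≤v k ⨾ neg-cancel (M k c) v ≤w k ⨾ M-lookup k c k ℕ.≤-refl
      where
      ≤w : neg (M k c) ⊑ neg v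
      ≤w = J-meet i wᵢ (neg (M k c))
             (neg-swapˡ a (M k c) (M-greatest k c (neg a) a≤c))
             (neg-swapˡ b (M k c) (M-greatest k c (neg b) b≤c)) ⨟
           J-least i wᵢ (neg v) (𝕀.refl {wᵢ})
    below : ∀ y → x 𝕀.≤ π (neg y) k → y ⊑ neg v
    below y x≤y = neg-swapʳ v y (v≤J ⨟ J-least k x (neg y) x≤y)

  const⊑M : ∀ x → / x / ⊑ M last x
  const⊑M x = M-greatest last x / x / (𝕀.refl {x})

  M⊑const : ∀ x → M last x ⊑ / x /
  M⊑const x i = M-lookup last x i (≤fromℕ i)

-- The image of the vertex (0,1,...,1)

neg-M-zero : ∀ {m} (𝒩 : Map (𝕃 (suc m))) → IsStrongDimFuzzyNegation (suc m) 𝒩 →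
  1𝕀 𝕀.≤ π (𝒩 ⟨$⟩ M zero 0𝕀) (fromℕ m)
neg-M-zero {zero} 𝒩 strong = neg-≤0 (M zero 0𝕀) (M⊑const 0𝕀) zero
  where open Strong 𝒩 strong
neg-M-zero {suc m} 𝒩 strong = by-contra 1𝕀 c λ 1≰c →
  neg-J-cases (M zero 0𝕀) (suc zero) 1𝕀 (M-inject₁⊑J-suc zero) (J-suc⊑M-inject₁ zero) last λ
    { (inj₁ 1≤c) → 1≰c 1≤c
    ; (inj₂ c≤w) → between c c≰0 λ
        (z , z≤c , z≰0 , c≰z) → no-constant-between z z≤c z≰0 c≰z c≤w }
  where
  open Strong 𝒩 strong
  last : Fin (suc (suc m))
  last = fromℕ (suc m)
  w : Increasing (suc (suc m))
  w = neg (M zero 0𝕀)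
  c : UnitInterval
  c = π w last
  c≰0 : ¬ (c 𝕀.≤ 0𝕀)
  c≰0 c≤0 = 1≰0
    (neg-≤0 w (λ i → Increasing.mono w (≤fromℕ i) ⨾ c≤0) zero ⨾
     neg²≤ (M zero 0𝕀) zero ⨾
     M-lookup {suc (suc m)} zero 0𝕀 zero ℕ.≤-refl)
  -- If `v₀ = 0`, then `v` lies below `M zero 0𝕀`, whence `c ≤ z`. If instead no entry of `v`
  -- exceeds `v₀`, then `v = / 1𝕀 /` and `z = 0`.
  no-constant-between : ∀ z → z 𝕀.≤ c → ¬ (z 𝕀.≤ 0𝕀) → ¬ (c 𝕀.≤ z) → / c / ⊑ w → ⊥
  no-constant-between z z≤c z≰0 c≰z c≤w =
    neg-M-cases (/ z /) last z (const⊑M z) (M⊑const z) zero λ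
      { (inj₁ v₀≤0) → c≰z (neg-swapˡ (/ z /) (M zero 0𝕀) (M-greatest zero 0𝕀 v v₀≤0) last)
      ; (inj₂ v≤v₀) → z≰0 (neg²≥ (/ z /) zero ⨾ neg-1≤ v (1≤v v≤v₀) zero)
      }
    where
    v : Increasing (suc (suc m))
    v = neg (/ z /)
    M≤v : M zero 0𝕀 ⊑ v
    M≤v = neg-swapʳ (/ c /) (M zero 0𝕀) c≤w ⨟ neg-anti (/ z /) (/ c /) (λ _ → z≤c)
    1≤v : v ⊑ / π v zero / → / 1𝕀 / ⊑ v
    1≤v v≤v₀ i =
      -- A second coordinate is essential here: `M zero 0𝕀` has its first 1 there, and the bound by
      -- `v₀` carries it back to coordinate `zero`.
      M-one {suc (suc m)} zero 0𝕀 (suc zero) z<s ⨾ M≤v (suc zero) ⨾ v≤v₀ (suc zero) ⨾ Increasing.mono v z≤n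

-- Images of vertices and constants

module Characterisation {m : ℕ} (𝒩 : Map (𝕃 (suc m)))
                        (strong : IsStrongDimFuzzyNegation (suc m) 𝒩) where

  open Strong 𝒩 strong

  private
    last : Fin (suc m)
    last = fromℕ m

  1≤neg-M : ∀ i → 1𝕀 𝕀.≤ π (neg (M i 0𝕀)) (opposite i)
  1≤neg-M = <-weakInduction (λ i → 1𝕀 𝕀.≤ π (neg (M i 0𝕀)) (opposite i))
                            (neg-M-zero 𝒩 strong) step
    where
    step : ∀ i → 1𝕀 𝕀.≤ π (neg (M (inject₁ i) 0𝕀)) (opposite (inject₁ i)) →
                 1𝕀 𝕀.≤ π (neg (M (suc i) 0𝕀)) (inject₁ (opposite i))
    step i ih = by-cases 1𝕀 (π w k)
      (neg-M-cases (M (suc i) 0𝕀) (suc i) 0𝕀 (λ _ _ h → h) (λ _ _ h → h) k)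
      -- `wₖ = 0` would identify `w` with `w′`, against injectivity of `neg`. Otherwise no entry of
      -- `w` exceeds `wₖ`, and the next entry is already 1.
      (λ wₖ≤0 → ⊥-elim (1≰0
        (M-one (inject₁ i) 0𝕀 (suc i) (inject₁<suc i) ⨾
         neg-cancel (M (suc i) 0𝕀) (M (inject₁ i) 0𝕀) (w≤w′ wₖ≤0) (suc i) ⨾
         M-lookup (suc i) 0𝕀 (suc i) ℕ.≤-refl)))
      (λ w≤wₖ → 1≤w′ ⨾ w′≤w (suc (opposite i)) ⨾ w≤wₖ (suc (opposite i)))
      where
      k : Fin (suc m)
      k = inject₁ (opposite i)
      w w′ : Increasing (suc m)
      w  = neg (M (suc i) 0𝕀)
      w′ = neg (M (inject₁ i) 0𝕀)
      1≤w′ : 1𝕀 𝕀.≤ π w′ (suc (opposite i))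
      1≤w′ = subst (λ j → 1𝕀 𝕀.≤ π w′ j) (opposite-inject₁ i) ih
      w′≤w : w′ ⊑ w
      w′≤w = neg-anti (M (suc i) 0𝕀) (M (inject₁ i) 0𝕀)
        (M-greatest (inject₁ i) 0𝕀 (M (suc i) 0𝕀)
          (M-lookup (suc i) 0𝕀 (inject₁ i) (ℕ.<⇒≤ (inject₁<suc i))))
      w≤w′ : π w k 𝕀.≤ 0𝕀 → w ⊑ w′
      w≤w′ wₖ≤0 = M-greatest k 0𝕀 w wₖ≤0 ⨟ M-inject₁⊑J-suc (opposite i) ⨟
                  J-least (suc (opposite i)) 1𝕀 w′ 1≤w′

  neg-const : ∀ x i → neg (/ x /) ⊑ / π (neg (/ x /)) i /
  neg-const x i j = by-cases (π w j) (π w i)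
    (neg-M-cases (/ x /) last x (const⊑M x) (M⊑const x) i)
    -- `wᵢ = 0` puts `w` below `M i 0𝕀`, so `neg (M i 0𝕀)`, which has an entry 1, lies below
    -- `/ x /`; hence `x = 1` and `w = / 0𝕀 /`.
    (λ wᵢ≤0 → neg-1≤ (/ x /) (λ _ →
        1≤neg-M i ⨾
        neg-swapˡ (/ x /) (M i 0𝕀) (M-greatest i 0𝕀 w wᵢ≤0) (opposite i)) j ⨾
      0≤ (π w i))
    (λ w≤wᵢ → w≤wᵢ j)
    where
    w : Increasing (suc m)
    w = neg (/ x /)

  -- Dual to `1≤neg-M`, by downward induction; the base case rests on constants going to constants.
  neg-J≤0 : ∀ i → π (neg (J i 1𝕀)) (opposite i) 𝕀.≤ 0𝕀
  neg-J≤0 = >-weakInduction (λ i → π (neg (J i 1𝕀)) (opposite i) 𝕀.≤ 0𝕀) base step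
    where
    base : π (neg (J last 1𝕀)) (opposite last) 𝕀.≤ 0𝕀
    base = neg²≥ (/ c /) zero ⨾ neg-1≤ (neg (/ c /)) 1≤ zero
      where
      w : Increasing (suc m)
      w = neg (J last 1𝕀)
      c : UnitInterval
      c = π w (opposite last)
      c≤w : / c / ⊑ w
      -- `opposite last` is the least coordinate but does not compute to `zero`, so `i` is compared
      -- with it as `opposite (opposite i)`.
      c≤w i = Increasing.mono w (opposite-anti-≤ (≤fromℕ (opposite i))) ⨾
              subst (λ j → π w (opposite (opposite i)) 𝕀.≤ π w j) (opposite-involutive i)
                    (𝕀.refl {π w (opposite (opposite i))})
      1≤ : / 1𝕀 / ⊑ neg (/ c /)
      1≤ j = J-lookup last 1𝕀 last ℕ.≤-refl ⨾ neg-swapʳ (/ c /) (J last 1𝕀) c≤w last ⨾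
             neg-const c j last

    step : ∀ i → π (neg (J (suc i) 1𝕀)) (inject₁ (opposite i)) 𝕀.≤ 0𝕀 →
                 π (neg (J (inject₁ i) 1𝕀)) (opposite (inject₁ i)) 𝕀.≤ 0𝕀
    step i ih = subst (λ j → π w j 𝕀.≤ 0𝕀) (sym (opposite-inject₁ i)) (by-cases (π w k) 0𝕀
      (neg-J-cases (J (inject₁ i) 1𝕀) (inject₁ i) 1𝕀 (λ _ _ h → h) (λ _ _ h → h) k)
      (λ 1≤wₖ → ⊥-elim (1≰0
        (J-lookup (inject₁ i) 1𝕀 (inject₁ i) ℕ.≤-refl ⨾
         neg-cancel (J (suc i) 1𝕀) (J (inject₁ i) 1𝕀) (w′≤w 1≤wₖ) (inject₁ i) ⨾
         J-zero (suc i) 1𝕀 (inject₁ i) (inject₁<suc i))))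
      (λ wₖ≤w → wₖ≤w (inject₁ (opposite i)) ⨾ w≤w′ (inject₁ (opposite i)) ⨾ ih))
      where
      k : Fin (suc m)
      k = suc (opposite i)
      w w′ : Increasing (suc m)
      w  = neg (J (inject₁ i) 1𝕀)
      w′ = neg (J (suc i) 1𝕀)
      w≤w′ : w ⊑ w′
      w≤w′ = neg-anti (J (suc i) 1𝕀) (J (inject₁ i) 1𝕀)
        (J-least (suc i) 1𝕀 (J (inject₁ i) 1𝕀)
          (J-lookup (inject₁ i) 1𝕀 (suc i) (ℕ.<⇒≤ (inject₁<suc i))))
      w′≤w : 1𝕀 𝕀.≤ π w k → w′ ⊑ w
      w′≤w 1≤wₖ = M-greatest (inject₁ (opposite i)) 0𝕀 w′ ih ⨟ M-inject₁⊑J-suc (opposite i) ⨟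
                  J-least k 1𝕀 w 1≤wₖ

  -- The induced negation on [0,1]

  N : UnitInterval → UnitInterval
  N x = π (neg (/ x /)) zero

  N≤neg : ∀ x → / N x / ⊑ neg (/ x /)
  N≤neg x i = Increasing.mono (neg (/ x /)) z≤n

  neg≤N : ∀ x → neg (/ x /) ⊑ / N x /
  neg≤N x = neg-const x zero

  -- By antitonicity it suffices that `neg z` lies below `J i (π x i)`, which is tested separately
  -- on the constant `/ π x i /` and the vertex `J i 1𝕀`.
  neg-upper : ∀ x i → π (neg x) (opposite i) 𝕀.≤ N (π x i)
  neg-upper x i = neg-swapˡ z x z′≤x (opposite i) ⨾ M-lookup (opposite i) y (opposite i) ℕ.≤-refl
    where
    y : UnitInterval
    y = N (π x i)
    z : Increasing (suc m)
    z = M (opposite i) y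
    z′≤x : neg z ⊑ x
    z′≤x =
      J-meet i (π x i) (neg z)
        (neg-swapˡ (/ π x i /) z
          (M-greatest (opposite i) y (neg (/ π x i /)) (neg≤N (π x i) (opposite i))))
        (neg-swapˡ (J i 1𝕀) z
          (M-greatest (opposite i) y (neg (J i 1𝕀)) (neg-J≤0 i ⨾ 0≤ y))) ⨟
      J-least i (π x i) x (𝕀.refl {π x i})

  neg-lower : ∀ x i → N (π x i) 𝕀.≤ π (neg x) (opposite i)
  neg-lower x i = J-lookup (opposite i) y (opposite i) ℕ.≤-refl ⨾ neg-swapʳ x z x≤z′ (opposite i)
    where
    y : UnitInterval
    y = N (π x i)
    z : Increasing (suc m)
    z = J (opposite i) y
    x≤z′ : x ⊑ neg z
    x≤z′ =
      M-greatest i (π x i) x (𝕀.refl {π x i}) ⨟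
      M-join i (π x i) (neg z)
        (neg-swapʳ z (/ π x i /)
          (J-least (opposite i) y (neg (/ π x i /)) (N≤neg (π x i) (opposite i))))
        (neg-swapʳ z (M i 0𝕀)
          (J-least (opposite i) y (neg (M i 0𝕀)) (≤1 y ⨾ 1≤neg-M i)))

  open IsStrongDimFuzzyNegation (suc m) strong

  N-map : Map 𝕀
  N-map = record { to = N ; cong = λ {x} {y} x≈y → Func.cong 𝒩 {/ x /} {/ y /} (λ _ → x≈y) zero }

  N-strong : IsStrongFuzzyNegation N-map
  N-strong = record
    { isNegation = record
      { N𝟘≈𝟙     = N𝟘≈𝟙 zero
      ; N𝟙≈𝟘     = N𝟙≈𝟘 zero
      ; antitone = λ {x} {y} y≤x → neg-anti (/ y /) (/ x /) (λ _ → y≤x) zero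
      }
    ; involutive = λ x →
        (neg-swapˡ (/ x /) (/ N x /) (neg≤N x) zero) ,
        (neg-swapʳ (/ N x /) (/ x /) (N≤neg x) zero)
    }

  neg≈tilde : ∀ x → Poset._≈_ (𝕃 (suc m)) (neg x)
    (tilde N-map (IsStrongFuzzyNegation.isNegation N-strong) ⟨$⟩ x)
  neg≈tilde x i = upper , lower
    where
    upper : π (neg x) i 𝕀.≤ N (π x (opposite i))
    upper = subst (λ j → π (neg x) j 𝕀.≤ N (π x (opposite i))) (opposite-involutive i)
                  (neg-upper x (opposite i))
    lower : N (π x (opposite i)) 𝕀.≤ π (neg x) i
    lower = subst (λ j → N (π x (opposite i)) 𝕀.≤ π (neg x) j) (opposite-involutive i)
                  (neg-lower x (opposite i))

-- The converse: negations of the form `tilde N`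

tilde-strong : ∀ {n} (𝒩 : Map (𝕃 n)) (N : Map 𝕀) (strong : IsStrongFuzzyNegation N) →
  (∀ 𝐱 → Poset._≈_ (𝕃 n) (𝒩 ⟨$⟩ 𝐱)
     (tilde N (IsStrongFuzzyNegation.isNegation strong) ⟨$⟩ 𝐱)) →
  IsStrongDimFuzzyNegation n 𝒩
tilde-strong {n} 𝒩 N strong 𝒩≈Ñ = record
  { isNegation = record
    { N𝟘≈𝟙     = λ i → ≈-trans (𝒩≈Ñ (/ 0𝕀 /) i) N𝟘≈𝟙
    ; N𝟙≈𝟘     = λ i → ≈-trans (𝒩≈Ñ (/ 1𝕀 /) i) N𝟙≈𝟘
    ; antitone = λ {x} {y} y≤x i →
        lhs≤rhs (𝒩≈Ñ x i) ⨾
        antitone {π x (opposite i)} {π y (opposite i)} (y≤x (opposite i)) ⨾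
        rhs≤lhs (𝒩≈Ñ y i)
    }
  ; involutive = λ x i →
      -- The two reversals compose to `opposite (opposite i)` and cancel, leaving `N` applied twice
      -- to coordinate `i`.
      ≈-trans (𝒩≈Ñ (𝒩 ⟨$⟩ x) i)
      (≈-trans (Func.cong N (𝒩≈Ñ x (opposite i)))
      (≈-trans (involutive (π x (opposite (opposite i))))
               (𝕀.Eq.reflexive (cong (π x) (opposite-involutive i)))))
  }
  where
  open IsStrongFuzzyNegation strong
  open Poset.Eq ℝ-poset using () renaming (trans to ≈-trans)

theorem24 : (n : ℕ) → n ≥ 1 → (𝒩 : Map (𝕃 n)) →
    IsStrongDimFuzzyNegation n 𝒩 ⇔
    (∃[ N ] Σ[ strong ∈ IsStrongFuzzyNegation N ]
    (∀ 𝐱 → Poset._≈_ (𝕃 n) (𝒩 ⟨$⟩ 𝐱) (tilde N (IsStrongFuzzyNegation.isNegation strong) ⟨$⟩ 𝐱)))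
theorem24 (suc m) _ 𝒩 = mk⇔
  (λ strong → let open Characterisation 𝒩 strong in N-map , N-strong , neg≈tilde)
  (λ (N , strong , 𝒩≈Ñ) → tilde-strong 𝒩 N strong 𝒩≈Ñ)
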